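{- Let $m\geq 1$, let $i_1,i_2,\ldots,i_m\geq 1$ and $q\geq 2$ be positive integers. For a composition $\xi=(\xi_1,\xi_2,\ldots,\xi_p)\in\mathcal{C}_m$ (where $p$ is the number of parts of $\xi$) and a permutation $\sigma\in\mathcal{S}_m$, denote $$J_c(\xi,\sigma)=i_{\sigma(\xi_1+\cdots+\xi_{c-1}+1)}+\cdots+i_{\sigma(\xi_1+\cdots+\xi_c)},\qquad c=1,2,\ldots,p.$$ Then $$S_{i_1i_2\cdots i_m,q}=\sum_{\xi\in\mathcal{C}_m}\sum_{\sigma\in\mathcal{S}_m}\frac{1}{\xi_1!\,\xi_2!\cdots\xi_p!}\Big\{\zeta\big(q,J_1(\xi,\sigma),J_2(\xi,\sigma),\ldots,J_p(\xi,\sigma)\big)+\zeta\big(q+J_1(\xi,\sigma),J_2(\xi,\sigma),\ldots,J_p(\xi,\sigma)\big)\Big\}.$$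
   Context: Generalized harmonic numbers: $H_n^{(r)}=\sum_{k=1}^n k^{ -r}$ for positive integers $n,r$. Euler sum: $S_{i_1i_2\cdots i_m,q}=\sum_{n=1}^{\infty}\frac{H_n^{(i_1)}H_n^{(i_2)}\cdots H_n^{(i_m)}}{n^q}$. Multiple zeta values: for positive integers $s_1,\ldots,s_k$ with $s_1>1$, $\zeta(s_1,s_2,\ldots,s_k)=\sum_{n_1>n_2>\cdots>n_k\geq 1}\frac{1}{n_1^{s_1}n_2^{s_2}\cdots n_k^{s_k}}$. $\mathcal{S}_m$ is the symmetric group of all permutations of $\{1,\ldots,m\}$. A composition of $m$ is an ordered tuple of positive integers whose elements sum to $m$; $\mathcal{C}_m$ is the set of all compositions of $m$. For $c=1$, the empty sum $\xi_1+\cdots+\xi_{c-1}$ is $0$. -}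

module Defs where

open import Data.Fin.Base using (Fin; zero; suc)
open import Data.Fin.Permutation using (Permutation′; _⟨$⟩ʳ_; insert) renaming (id to idₚ)
open import Data.Integer.Base using (+_; +[1+_]; -[1+_])
import Data.Integer.Base as ℤ
import Data.Integer.Properties as ℤ
import Data.Irrelevant as Irrelevant
open import Data.List.Base as List using (List; []; _∷_; allFin; concatMap)
open import Data.List.NonEmpty.Base as List⁺ using (List⁺; _∷_)
open import Data.Nat.Base as ℕ using (ℕ; zero; suc; NonZero; _!)
import Data.Nat.Properties as ℕ
open import Data.Nat.Solver using () renaming (module +-*-Solver to ℕ-Solver)
open import Data.Product.Base using (∃; _×_; _,_; proj₁; proj₂)
open import Data.Rational.Base hiding (NonZero; truncate; _≃_)
open import Data.Rational.Properties hiding (_≟_)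
open import Data.Rational.Solver using (module +-*-Solver)
open import Data.Rational.Unnormalised.Base as ℚᵘ using (mkℚᵘ; *≡*; *<*)
import Data.Rational.Unnormalised.Properties as ℚᵘ
open import Data.Refinement.Base using (Refinement; Refinement-syntax; value; proof)
open import Data.Sum.Base using (inj₁; inj₂)
open import Data.Vec.Functional using (Vector; take; drop; foldr)
open import Relation.Binary.PropositionalEquality
  using (_≡_; refl; sym; trans; cong; cong₂; subst; subst₂)

ℕ⁺ : Set
ℕ⁺ = [ n ∈ ℕ ∣ NonZero n ]

infixl 6 _+⁺_

_+⁺_ : ℕ⁺ → ℕ⁺ → ℕ⁺
a +⁺ b = record
  { value = value a ℕ.+ value b
  ; proof = Irrelevant.map (+-nonZero (value a)) (proof a)
  }
  where
  +-nonZero : ∀ m → NonZero m → NonZero (m ℕ.+ value b)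
  +-nonZero (suc m) _ = _

sum⁺ : ∀ {k} → Vector ℕ⁺ (suc k) → ℕ⁺
sum⁺ {zero}  v = v zero
sum⁺ {suc k} v = v zero +⁺ sum⁺ (λ j → v (suc j))

-- Compositions of m with at least one part.  A part is given by its
-- predecessor: k stands for the part k + 1.
data Composition : ℕ → Set where
  single : ∀ k → Composition (suc k)
  _∷_    : ∀ k {n} → Composition n → Composition (suc k ℕ.+ n)

-- (ξ₁, ξ₂, …) ↦ (ξ₁ + 1, ξ₂, …)
increaseHead : ∀ {n} → Composition n → Composition (suc n)
increaseHead (single k) = single (suc k)
increaseHead (k ∷ ξ)    = suc k ∷ ξ

-- Every composition of every m ≥ 1, exactly once: for m ≥ 2 the first
-- part either equals 1 or is larger.
compositions : ∀ m → List (Composition m)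
compositions 0             = []
compositions 1             = single 0 ∷ []
compositions (suc (suc m)) =
  List.map (0 ∷_) (compositions (suc m)) List.++
  List.map increaseHead (compositions (suc m))

-- Every permutation, exactly once: choose the image k of the first
-- element and a bijection between the remaining ones.
permutations : ∀ m → List (Permutation′ m)
permutations zero    = idₚ ∷ []
permutations (suc m) =
  concatMap (λ k → List.map (insert zero k) (permutations m)) (allFin (suc m))

factorials : ∀ {m} → Composition m → ℕ
factorials (single k) = suc k !
factorials (k ∷ ξ)    = suc k ! ℕ.* factorials ξ

factorials≢0 : ∀ {m} (ξ : Composition m) → NonZero (factorials ξ)
factorials≢0 (single k) = suc k ℕ.!≢0
factorials≢0 (k ∷ ξ)    =
  ℕ.m*n≢0 (suc k !) (factorials ξ) {{suc k ℕ.!≢0}} {{factorials≢0 ξ}}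

-- The c-th entry is the sum of v over the positions
-- ξ₁ + ⋯ + ξ_{c-1} + 1, …, ξ₁ + ⋯ + ξ_c.
blockSums : ∀ {m} → Composition m → Vector ℕ⁺ m → List⁺ ℕ⁺
blockSums (single k) v = sum⁺ v ∷ []
blockSums (k ∷ ξ)    v =
  sum⁺ (take (suc k) v) List⁺.∷⁺ blockSums ξ (drop (suc k) v)

J : ∀ {m} → (Fin m → ℕ⁺) → Composition m → Permutation′ m → List⁺ ℕ⁺
J i ξ σ = blockSums ξ (λ j → i (σ ⟨$⟩ʳ j))

IsCauchy : (ℕ → ℚ) → Set
IsCauchy x = ∀ ε → 0ℚ < ε →
  ∃ λ N → ∀ m n → N ℕ.≤ m → N ℕ.≤ n → ∣ x m - x n ∣ < ε

-- A Cauchy sequence stands for its limit; equality of reals is _≃_.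
record ℝ : Set where
  constructor mkℝ
  field
    approx   : ℕ → ℚ
    isCauchy : IsCauchy approx
open ℝ public

infix 4 _≃_

_≃_ : ℝ → ℝ → Set
x ≃ y = ∀ ε → 0ℚ < ε →
  ∃ λ N → ∀ n → N ℕ.≤ n → ∣ approx x n - approx y n ∣ < ε

private
  open +-*-Solver using (solve; _:+_; _:*_; _:-_; :-_; _:=_; con)
  open ≤-Reasoning

  0≤* : ∀ {p q} → 0ℚ ≤ p → 0ℚ ≤ q → 0ℚ ≤ p * q
  0≤* {p} {q} 0≤p 0≤q = nonNegative⁻¹ (p * q)
    {{nonNeg*nonNeg⇒nonNeg p {{nonNegative 0≤p}} q {{nonNegative 0≤q}}}}

  0<* : ∀ {p q} → 0ℚ < p → 0ℚ < q → 0ℚ < p * q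
  0<* {p} {q} 0<p 0<q = positive⁻¹ (p * q)
    {{pos*pos⇒pos p {{positive 0<p}} q {{positive 0<q}}}}

  0≤+ : ∀ {p q} → 0ℚ ≤ p → 0ℚ ≤ q → 0ℚ ≤ p + q
  0≤+ {p} {q} 0≤p 0≤q = nonNegative⁻¹ (p + q)
    {{nonNeg+nonNeg⇒nonNeg p {{nonNegative 0≤p}} q {{nonNegative 0≤q}}}}

  *-monoʳ : ∀ {p q r} → 0ℚ ≤ r → p ≤ q → r * p ≤ r * q
  *-monoʳ {r = r} 0≤r = *-monoˡ-≤-nonNeg r {{nonNegative 0≤r}}

  *-monoˡ : ∀ {p q r} → 0ℚ ≤ r → p ≤ q → p * r ≤ q * r
  *-monoˡ {r = r} 0≤r = *-monoʳ-≤-nonNeg r {{nonNegative 0≤r}}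

  *-mono : ∀ {p p′ q q′} → 0ℚ ≤ q → 0ℚ ≤ p′ → p ≤ p′ → q ≤ q′ → p * q ≤ p′ * q′
  *-mono 0≤q 0≤p′ p≤p′ q≤q′ = ≤-trans (*-monoˡ 0≤q p≤p′) (*-monoʳ 0≤p′ q≤q′)

  p≤p+q : ∀ p {q} → 0ℚ ≤ q → p ≤ p + q
  p≤p+q p {q} 0≤q = subst (_≤ p + q) (+-identityʳ p) (+-monoʳ-≤ p 0≤q)

  p≤q+p : ∀ p {q} → 0ℚ ≤ q → p ≤ q + p
  p≤q+p p {q} 0≤q = subst (p ≤_) (+-comm p q) (p≤p+q p 0≤q)

  ½+½ : ∀ ε → ½ * ε + ½ * ε ≡ ε
  ½+½ ε = trans (sym (*-distribʳ-+ ε ½ ½)) (*-identityˡ ε)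

  +-cauchy : ∀ x y → IsCauchy x → IsCauchy y → IsCauchy (λ n → x n + y n)
  +-cauchy x y cx cy ε 0<ε
    with N , px ← cx (½ * ε) (0<* (positive⁻¹ ½) 0<ε)
       | M , py ← cy (½ * ε) (0<* (positive⁻¹ ½) 0<ε) =
    N ℕ.⊔ M , λ m n N≤m N≤n → begin-strict
      ∣ (x m + y m) - (x n + y n) ∣
        ≡⟨ cong ∣_∣ (solve 4 (λ a b c d → (a :+ b) :- (c :+ d) := (a :- c) :+ (b :- d))
             refl (x m) (y m) (x n) (y n)) ⟩
      ∣ (x m - x n) + (y m - y n) ∣
        ≤⟨ ∣p+q∣≤∣p∣+∣q∣ (x m - x n) (y m - y n) ⟩
      ∣ x m - x n ∣ + ∣ y m - y n ∣
        <⟨ +-mono-< (px m n (ℕ.m⊔n≤o⇒m≤o N M N≤m) (ℕ.m⊔n≤o⇒m≤o N M N≤n))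
                    (py m n (ℕ.m⊔n≤o⇒n≤o N M N≤m) (ℕ.m⊔n≤o⇒n≤o N M N≤n)) ⟩
      ½ * ε + ½ * ε
        ≡⟨ ½+½ ε ⟩
      ε ∎

  *-cauchy : ∀ c x → IsCauchy x → IsCauchy (λ n → c * x n)
  *-cauchy c x cx ε 0<ε = proj₁ near , λ m n N≤m N≤n → begin-strict
      ∣ c * x m - c * x n ∣
        ≡⟨ cong ∣_∣ (solve 3 (λ c a b → c :* a :- c :* b := c :* (a :- b)) refl c (x m) (x n)) ⟩
      ∣ c * (x m - x n) ∣    ≡⟨ ∣p*q∣≡∣p∣*∣q∣ c (x m - x n) ⟩
      ∣ c ∣ * ∣ x m - x n ∣  ≤⟨ *-monoˡ (0≤∣p∣ (x m - x n)) (p≤q+p ∣ c ∣ (nonNegative⁻¹ 1ℚ)) ⟩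
      d * ∣ x m - x n ∣      <⟨ *-monoʳ-<-pos d (proj₂ near m n N≤m N≤n) ⟩
      d * (d⁻¹ * ε)          ≡⟨ *-assoc d d⁻¹ ε ⟨
      d * d⁻¹ * ε            ≡⟨ cong (_* ε) (*-inverseʳ d) ⟩
      1ℚ * ε                 ≡⟨ *-identityˡ ε ⟩
      ε                      ∎
    where
    d = 1ℚ + ∣ c ∣
    instance
      d-pos : Positive d
      d-pos = pos+nonNeg⇒pos 1ℚ ∣ c ∣ {{∣-∣-nonNeg c}}
      d≢0 = pos⇒nonZero d
    d⁻¹ = 1/ d
    near = cx (d⁻¹ * ε) (0<* (positive⁻¹ d⁻¹ {{1/pos⇒pos d}}) 0<ε)

0ℝ : ℝ
0ℝ = mkℝ (λ _ → 0ℚ) (λ ε 0<ε → 0 , λ _ _ _ _ → 0<ε)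

infixl 6 _+ℝ_
infixr 7 _·_

_+ℝ_ : ℝ → ℝ → ℝ
x +ℝ y = mkℝ (λ n → approx x n + approx y n) (+-cauchy (approx x) (approx y) (isCauchy x) (isCauchy y))

_·_ : ℚ → ℝ → ℝ
c · x = mkℝ (λ n → c * approx x n) (*-cauchy c (approx x) (isCauchy x))

sumℝ : ∀ {A : Set} → List A → (A → ℝ) → ℝ
sumℝ xs f = List.foldr (λ x s → f x +ℝ s) 0ℝ xs

-- f 0 + ⋯ + f (n - 1)
Σ< : ℕ → (ℕ → ℚ) → ℚ
Σ< zero    f = 0ℚ
Σ< (suc n) f = Σ< n f + f n

infix 8 1/_^_

1/_^_ : (n : ℕ) .{{_ : NonZero n}} → ℕ → ℚ
1/ n ^ r = ((+ 1) / (n ℕ.^ r)) {{ℕ.m^n≢0 n r}}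

H : ℕ → ℕ⁺ → ℚ
H n r = Σ< n (λ k → 1/ suc k ^ value r)

-- The sum of 1 / (n₁^s₁ ⋯ nₖ^sₖ) over N ≥ n₁ > n₂ > ⋯ > nₖ ≥ 1; in the
-- recursion n₁ = suc n, so that n ≥ n₂.
mzvSum : ℕ → List ℕ → ℚ
mzvSum N []       = 1ℚ
mzvSum N (s ∷ ss) = Σ< N (λ n → 1/ suc n ^ s * mzvSum n ss)

-- The sum of H_n^(i₁) ⋯ H_n^(iₘ) / n^q over 1 ≤ n ≤ N.
eulerSum : ∀ {m} → ℕ → (Fin m → ℕ⁺) → ℕ → ℚ
eulerSum N i q = Σ< N (λ n → 1/ suc n ^ q * foldr _*_ 1ℚ (λ j → H (suc n) (i j)))

-- The terms of both kinds of series are bounded by a multiple of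
-- p k / (k + 1)², where p k = (1 + δ) (1 + δ/2) ⋯ (1 + δ/k) with δ = ½,
-- and p k / ((k + 1) (k + 2)) is 2 (r k - r (k + 1)) for
-- r k = p k / (k + 1), which tends to 0 since (r k)² ≤ 2 / (k + 2).
private
  u : ℕ → ℚ
  u k = + 1 / suc k

  toℚᵘ-u : ∀ k → toℚᵘ (u k) ℚᵘ.≃ mkℚᵘ (+ 1) k
  toℚᵘ-u k = toℚᵘ-fromℚᵘ (mkℚᵘ (+ 1) k)

  0<u : ∀ k → 0ℚ < u k
  0<u k = positive⁻¹ (u k) {{normalize-pos 1 (suc k)}}

  0≤u : ∀ k → 0ℚ ≤ u k
  0≤u k = <⇒≤ (0<u k)

  /-* : ∀ a b .{{_ : NonZero a}} .{{_ : NonZero b}} .{{_ : NonZero (a ℕ.* b)}} →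
        (+ 1) / (a ℕ.* b) ≡ (+ 1 / a) * (+ 1 / b)
  /-* a@(suc a-1) b@(suc b-1) = toℚᵘ-injective (ℚᵘ.≃-trans
    (toℚᵘ-fromℚᵘ (mkℚᵘ (+ 1) (b-1 ℕ.+ a-1 ℕ.* b)))
    (ℚᵘ.≃-sym (ℚᵘ.≃-trans (toℚᵘ-homo-* (u a-1) (u b-1))
                          (ℚᵘ.*-cong (toℚᵘ-u a-1) (toℚᵘ-u b-1)))))

  module S = ℕ-Solver

  u-step : ∀ k → u k ≡ u (suc k) + u k * u (suc k)
  u-step k = toℚᵘ-injective (ℚᵘ.≃-trans (toℚᵘ-u k) (ℚᵘ.≃-trans (*≡* eq) (ℚᵘ.≃-sym
    (ℚᵘ.≃-trans (toℚᵘ-homo-+ (u (suc k)) (u k * u (suc k)))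
      (ℚᵘ.+-cong (toℚᵘ-u (suc k))
        (ℚᵘ.≃-trans (toℚᵘ-homo-* (u k) (u (suc k)))
                    (ℚᵘ.*-cong (toℚᵘ-u k) (toℚᵘ-u (suc k)))))))))
    where
    a = suc k
    b = suc (suc k)
    eqℕ : 1 ℕ.* (b ℕ.* (a ℕ.* b)) ≡ (1 ℕ.* (a ℕ.* b) ℕ.+ 1 ℕ.* b) ℕ.* a
    eqℕ = S.solve 1 (λ k → let a = S.con 1 S.:+ k ; b = S.con 2 S.:+ k in
      S.con 1 S.:* (b S.:* (a S.:* b)) S.:= (S.con 1 S.:* (a S.:* b) S.:+ S.con 1 S.:* b) S.:* a)
      refl k
    eq : + 1 ℤ.* + (b ℕ.* (a ℕ.* b)) ≡ (+ 1 ℤ.* + (a ℕ.* b) ℤ.+ + 1 ℤ.* + b) ℤ.* + a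
    eq = cong +_ eqℕ

  0≤1/ : ∀ k s → 0ℚ ≤ 1/ suc k ^ s
  0≤1/ k s = nonNegative⁻¹ (1/ suc k ^ s)
    {{normalize-nonNeg 1 (suc k ℕ.^ s) {{ℕ.m^n≢0 (suc k) s}}}}

  1/-suc : ∀ k s → 1/ suc k ^ suc s ≡ u k * 1/ suc k ^ s
  1/-suc k s = /-* (suc k) (suc k ℕ.^ s)
    {{_}} {{ℕ.m^n≢0 (suc k) s}} {{ℕ.m^n≢0 (suc k) (suc s)}}

  u≤1 : ∀ k → u k ≤ 1ℚ
  u≤1 zero    = ≤-refl
  u≤1 (suc k) = ≤-trans
    (subst (u (suc k) ≤_) (sym (u-step k)) (p≤p+q (u (suc k)) (0≤* (0≤u k) (0≤u (suc k)))))
    (u≤1 k)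

  1/≤1 : ∀ k s → 1/ suc k ^ s ≤ 1ℚ
  1/≤1 k zero    = ≤-refl
  1/≤1 k (suc s) = begin
    1/ suc k ^ suc s    ≡⟨ 1/-suc k s ⟩
    u k * 1/ suc k ^ s  ≤⟨ *-mono (0≤1/ k s) (nonNegative⁻¹ 1ℚ) (u≤1 k) (1/≤1 k s) ⟩
    1ℚ                  ∎

  1/≤u : ∀ k s .{{_ : NonZero s}} → 1/ suc k ^ s ≤ u k
  1/≤u k (suc s) = begin
    1/ suc k ^ suc s    ≡⟨ 1/-suc k s ⟩
    u k * 1/ suc k ^ s  ≤⟨ *-monoʳ (0≤u k) (1/≤1 k s) ⟩
    u k * 1ℚ            ≡⟨ *-identityʳ (u k) ⟩
    u k                 ∎

  1/≤u² : ∀ k {q} → 2 ℕ.≤ q → 1/ suc k ^ q ≤ u k * u k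
  1/≤u² k {suc (suc q)} _ = begin
    1/ suc k ^ suc (suc q)    ≡⟨ 1/-suc k (suc q) ⟩
    u k * 1/ suc k ^ (suc q)  ≤⟨ *-monoʳ (0≤u k) (1/≤u k (suc q)) ⟩
    u k * u k                 ∎
  1/≤u² k {suc zero} (ℕ.s≤s ())

  p : ℚ → ℕ → ℚ
  p δ zero    = 1ℚ
  p δ (suc k) = p δ k + δ * (u k * p δ k)

  0≤p : ∀ {δ} → 0ℚ ≤ δ → ∀ k → 0ℚ ≤ p δ k
  0≤p 0≤δ zero    = nonNegative⁻¹ 1ℚ
  0≤p 0≤δ (suc k) = 0≤+ (0≤p 0≤δ k) (0≤* 0≤δ (0≤* (0≤u k) (0≤p 0≤δ k)))

  1≤p : ∀ {δ} → 0ℚ ≤ δ → ∀ k → 1ℚ ≤ p δ k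
  1≤p 0≤δ zero    = ≤-refl
  1≤p 0≤δ (suc k) =
    ≤-trans (1≤p 0≤δ k) (p≤p+q _ (0≤* 0≤δ (0≤* (0≤u k) (0≤p 0≤δ k))))

  δ γ : ℕ → ℚ
  δ zero    = ½
  δ (suc j) = (+ 1 / 3) * δ j
  γ zero    = + 2 / 1
  γ (suc j) = (+ 3 / 1) * γ j

  0≤δ : ∀ j → 0ℚ ≤ δ j
  0≤δ zero    = nonNegative⁻¹ ½
  0≤δ (suc j) = 0≤* (nonNegative⁻¹ (+ 1 / 3)) (0≤δ j)

  0≤γ : ∀ j → 0ℚ ≤ γ j
  0≤γ zero    = nonNegative⁻¹ (+ 2 / 1)
  0≤γ (suc j) = 0≤* (nonNegative⁻¹ (+ 3 / 1)) (0≤γ j)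

  δ≤1 : ∀ j → δ j ≤ 1ℚ
  δ≤1 zero    = ≤ᵇ⇒≤ _
  δ≤1 (suc j) = *-mono (0≤δ j) (nonNegative⁻¹ 1ℚ) (≤ᵇ⇒≤ {+ 1 / 3} {1ℚ} _) (δ≤1 j)

  γδ≡1 : ∀ j → γ j * δ j ≡ 1ℚ
  γδ≡1 zero    = refl
  γδ≡1 (suc j) = trans
    (solve 2 (λ g d → (con (+ 3 / 1) :* g) :* (con (+ 1 / 3) :* d) := g :* d) refl (γ j) (δ j))
    (γδ≡1 j)

  p²≤p : ∀ j k → p (δ (suc j)) k * p (δ (suc j)) k ≤ p (δ j) k
  p²≤p j zero    = ≤-refl
  p²≤p j (suc k) = begin
    (x + d * (u k * x)) * (x + d * (u k * x))
      ≡⟨ solve 3 (λ x d u → (x :+ d :* (u :* x)) :* (x :+ d :* (u :* x))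
                         := x :* x :+ (d :+ d :+ d :* (d :* u)) :* (u :* (x :* x))) refl x d (u k) ⟩
    x * x + (d + d + d * (d * u k)) * (u k * (x * x))
      ≤⟨ +-monoʳ-≤ (x * x) (*-monoˡ (0≤* (0≤u k) (0≤* 0≤x 0≤x)) (+-monoʳ-≤ (d + d)
           (*-monoʳ (0≤δ (suc j)) (*-mono (0≤u k) (nonNegative⁻¹ 1ℚ) (δ≤1 (suc j)) (u≤1 k))))) ⟩
    x * x + (d + d + d * 1ℚ) * (u k * (x * x))
      ≡⟨ cong (λ e → x * x + e * (u k * (x * x)))
           (solve 1 (λ d → con (+ 1 / 3) :* d :+ con (+ 1 / 3) :* d :+ con (+ 1 / 3) :* d :* con 1ℚ := d)
              refl (δ j)) ⟩
    x * x + δ j * (u k * (x * x))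
      ≤⟨ +-mono-≤ (p²≤p j k) (*-monoʳ (0≤δ j) (*-monoʳ (0≤u k) (p²≤p j k))) ⟩
    p (δ j) k + δ j * (u k * p (δ j) k) ∎
    where
    d = δ (suc j)
    x = p d k
    0≤x = 0≤p (0≤δ (suc j)) k

  Σ<-cong : ∀ {f g} → (∀ k → f k ≡ g k) → ∀ n → Σ< n f ≡ Σ< n g
  Σ<-cong f≡g zero    = refl
  Σ<-cong f≡g (suc n) = cong₂ _+_ (Σ<-cong f≡g n) (f≡g n)

  0≤Σ< : ∀ {f} → (∀ k → 0ℚ ≤ f k) → ∀ n → 0ℚ ≤ Σ< n f
  0≤Σ< 0≤f zero    = ≤-refl
  0≤Σ< 0≤f (suc n) = 0≤+ (0≤Σ< 0≤f n) (0≤f n)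

  at⁺ : ∀ (P : ℕ → Set) → (∀ s → .{{NonZero s}} → P s) → ∀ r → P (value r)
  at⁺ P h r with Irrelevant.[ r≢0 ] ← proof r = h (value r) {{r≢0}}

  Nonneg : (ℕ → ℚ) → Set
  Nonneg f = ∀ n → 0ℚ ≤ f n

  Bounded : (ℕ → ℚ) → Set
  Bounded f = ∀ j → ∃ λ C → 0ℚ ≤ C × ∀ n → f n ≤ C * p (δ j) n

  bounded-1 : Bounded (λ _ → 1ℚ)
  bounded-1 j = 1ℚ , nonNegative⁻¹ 1ℚ , λ n →
    ≤-trans (1≤p (0≤δ j) n) (≤-reflexive (sym (*-identityˡ (p (δ j) n))))

  bounded-* : ∀ {f g} → Nonneg f → Nonneg g → Bounded f → Bounded g → Bounded (λ n → f n * g n)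
  bounded-* {f} {g} 0≤f 0≤g bf bg j
    with C , 0≤C , f≤ ← bf (suc j) | D , 0≤D , g≤ ← bg (suc j) =
    C * D , 0≤* 0≤C 0≤D , λ n → let x = p (δ (suc j)) n in begin
      f n * g n
        ≤⟨ *-mono (0≤g n) (0≤* 0≤C (0≤p (0≤δ (suc j)) n)) (f≤ n) (g≤ n) ⟩
      C * x * (D * x)
        ≡⟨ solve 3 (λ C D x → C :* x :* (D :* x) := C :* D :* (x :* x)) refl C D x ⟩
      C * D * (x * x)
        ≤⟨ *-monoʳ (0≤* 0≤C 0≤D) (p²≤p j n) ⟩
      C * D * p (δ j) n ∎

  bounded-Σ : ∀ {f} → Nonneg f → Bounded f → ∀ s →
              Bounded (λ n → Σ< n (λ k → 1/ suc k ^ value s * f k))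
  bounded-Σ {f} 0≤f bf s j with C , 0≤C , f≤ ← bf j =
    C * γ j , 0≤Cγ , go
    where
    0≤Cγ = 0≤* 0≤C (0≤γ j)
    go : ∀ n → Σ< n (λ k → 1/ suc k ^ value s * f k) ≤ C * γ j * p (δ j) n
    go zero    = 0≤* 0≤Cγ (nonNegative⁻¹ 1ℚ)
    go (suc n) = begin
      Σ< n (λ k → 1/ suc k ^ value s * f k) + 1/ suc n ^ value s * f n
        ≤⟨ +-mono-≤ (go n) (*-mono (0≤f n) (0≤u n) 1/nˢ≤u (f≤ n)) ⟩
      C * γ j * x + u n * (C * x)
        ≡⟨ cong (λ e → C * γ j * x + e) (sym (*-identityˡ (u n * (C * x)))) ⟩
      C * γ j * x + 1ℚ * (u n * (C * x))
        ≡⟨ cong (λ e → C * γ j * x + e * (u n * (C * x))) (γδ≡1 j) ⟨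
      C * γ j * x + γ j * δ j * (u n * (C * x))
        ≡⟨ solve 5 (λ C g d u x → C :* g :* x :+ g :* d :* (u :* (C :* x))
                               := C :* g :* (x :+ d :* (u :* x))) refl C (γ j) (δ j) (u n) x ⟩
      C * γ j * (x + δ j * (u n * x)) ∎
      where
      x = p (δ j) n
      1/nˢ≤u = at⁺ (λ s → 1/ suc n ^ s ≤ u n) (λ s → 1/≤u n s) s

  0≤H : ∀ r n → 0ℚ ≤ H n r
  0≤H r = 0≤Σ< (λ k → 0≤1/ k (value r))

  bounded-H : ∀ r → Bounded (λ n → H n r)
  bounded-H r j with C , 0≤C , H≤ ← bounded-Σ (λ _ → nonNegative⁻¹ 1ℚ) bounded-1 r j =
    C , 0≤C , λ n →
      subst (_≤ C * p (δ j) n) (Σ<-cong (λ k → *-identityʳ (1/ suc k ^ value r)) n) (H≤ n)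

  0≤∏H : ∀ {m} (i : Fin m → ℕ⁺) n → 0ℚ ≤ foldr _*_ 1ℚ (λ j → H n (i j))
  0≤∏H {zero}  i n = nonNegative⁻¹ 1ℚ
  0≤∏H {suc m} i n = 0≤* (0≤H (i zero) n) (0≤∏H (λ j → i (suc j)) n)

  bounded-∏H : ∀ {m} (i : Fin m → ℕ⁺) → Bounded (λ n → foldr _*_ 1ℚ (λ j → H n (i j)))
  bounded-∏H {zero}  i = bounded-1
  bounded-∏H {suc m} i = bounded-* (0≤H (i zero)) (0≤∏H (λ j → i (suc j)))
    (bounded-H (i zero)) (bounded-∏H (λ j → i (suc j)))

  0≤mzvSum : ∀ ss n → 0ℚ ≤ mzvSum n ss
  0≤mzvSum []       n = nonNegative⁻¹ 1ℚ
  0≤mzvSum (s ∷ ss) n = 0≤Σ< (λ k → 0≤* (0≤1/ k s) (0≤mzvSum ss k)) n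

  bounded-mzvSum : ∀ ss → Bounded (λ n → mzvSum n (List.map value ss))
  bounded-mzvSum []       = bounded-1
  bounded-mzvSum (s ∷ ss) = bounded-Σ (0≤mzvSum (List.map value ss)) (bounded-mzvSum ss) s

  r : ℕ → ℚ
  r k = p ½ k * u k

  0≤r : ∀ k → 0ℚ ≤ r k
  0≤r k = 0≤* (0≤p (0≤δ 0) k) (0≤u k)

  r-step : ∀ k → r k ≡ r (suc k) + ½ * (r k * u (suc k))
  r-step k = trans (cong (p ½ k *_) (u-step k))
    (solve 3 (λ p u v → p :* (v :+ u :* v) := (p :+ con ½ :* (u :* p)) :* v :+ con ½ :* (p :* u :* v))
      refl (p ½ k) (u k) (u (suc k)))

  u≤2u : ∀ k → u k ≤ u (suc k) + u (suc k)
  u≤2u k = begin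
    u k                  ≡⟨ u-step k ⟩
    u (suc k) + u k * u (suc k)
      ≤⟨ +-monoʳ-≤ (u (suc k)) (*-monoˡ (0≤u (suc k)) (u≤1 k)) ⟩
    u (suc k) + 1ℚ * u (suc k)  ≡⟨ cong (λ e → u (suc k) + e) (*-identityˡ (u (suc k))) ⟩
    u (suc k) + u (suc k) ∎

  r²≤2u : ∀ k → r k * r k ≤ (+ 2 / 1) * u (suc k)
  r²≤2u zero    = ≤ᵇ⇒≤ _
  r²≤2u (suc k) = begin
    r (suc k) * r (suc k)
      ≡⟨ cong₂ _*_ r′≡ r′≡ ⟩
    (x - ½ * (x * v)) * (x - ½ * (x * v))
      ≡⟨ solve 2 (λ x v → (x :- con ½ :* (x :* v)) :* (x :- con ½ :* (x :* v))
                       := x :* x :* ((con 1ℚ :- con ½ :* v) :* (con 1ℚ :- con ½ :* v))) refl x v ⟩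
    x * x * (y * y)
      ≤⟨ *-monoˡ (≤-trans (nonNegative⁻¹ (¼ * ¼)) (y²≥)) (r²≤2u k) ⟩
    (+ 2 / 1) * v * (y * y)
      ≡⟨ *-assoc (+ 2 / 1) v (y * y) ⟩
    (+ 2 / 1) * (v * (y * y))
      ≤⟨ *-monoʳ (nonNegative⁻¹ (+ 2 / 1)) vy²≤w ⟩
    (+ 2 / 1) * w ∎
    where
    x = r k
    v = u (suc k)
    w = u (suc (suc k))
    y = 1ℚ - ½ * v
    ¼ = + 1 / 4
    r′≡ : r (suc k) ≡ x - ½ * (x * v)
    r′≡ = trans (solve 2 (λ a b → a := a :+ b :- b) refl (r (suc k)) (½ * (x * v)))
                (cong (_- ½ * (x * v)) (sym (r-step k)))
    ¼≤y : ¼ ≤ y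
    ¼≤y = begin
      ¼          ≤⟨ ≤ᵇ⇒≤ _ ⟩
      1ℚ - ½ * 1ℚ  ≤⟨ +-monoʳ-≤ 1ℚ (neg-antimono-≤ (*-monoʳ (nonNegative⁻¹ ½) (u≤1 (suc k)))) ⟩
      y ∎
    y²≥ : ¼ * ¼ ≤ y * y
    y²≥ = *-mono (nonNegative⁻¹ ¼) (≤-trans (nonNegative⁻¹ ¼) ¼≤y) ¼≤y ¼≤y
    0≤w-¼v : 0ℚ ≤ w - ¼ * v
    0≤w-¼v = begin
      0ℚ                  ≤⟨ 0≤* (nonNegative⁻¹ ½) (0≤u (suc (suc k))) ⟩
      ½ * w               ≡⟨ solve 1 (λ w → con ½ :* w := w :- con (+ 1 / 4) :* (w :+ w)) refl w ⟩
      w - ¼ * (w + w)     ≤⟨ +-monoʳ-≤ w (neg-antimono-≤ (*-monoʳ (nonNegative⁻¹ ¼) (u≤2u (suc k)))) ⟩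
      w - ¼ * v           ∎
    vy²≤w : v * (y * y) ≤ w
    vy²≤w = begin
      v * (y * y)
        ≤⟨ p≤p+q _ (0≤* 0≤w-¼v (0≤* (0≤u (suc k)) (0≤u (suc k)))) ⟩
      v * (y * y) + (w - ¼ * v) * (v * v)
        ≡⟨ solve 2 (λ v w → v :* ((con 1ℚ :- con ½ :* v) :* (con 1ℚ :- con ½ :* v))
                           :+ (w :- con (+ 1 / 4) :* v) :* (v :* v)
                         := v :- v :* (v :- v :* w)) refl v w ⟩
      v - v * (v - v * w)
        ≡⟨ cong (λ e → v - v * e) v-vw≡w ⟩
      v - v * w
        ≡⟨ v-vw≡w ⟩
      w ∎
      where
      v-vw≡w : v - v * w ≡ w
      v-vw≡w = trans (cong (_- v * w) (u-step (suc k)))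
                     (solve 2 (λ w t → w :+ t :- t := w) refl w (v * w))

  archimedean : ∀ c ε → 0ℚ ≤ c → 0ℚ < ε → ∃ λ N → ∀ n → N ℕ.≤ n → c * u n < ε
  archimedean c@(mkℚ -[1+ _ ] _ _) ε 0≤c 0<ε with () ← nonNegative 0≤c
  archimedean c ε@(mkℚ -[1+ _ ] _ _) 0≤c 0<ε with () ← positive 0<ε
  archimedean c ε@(mkℚ (+ 0) _ _) 0≤c 0<ε with () ← positive 0<ε
  archimedean c@(mkℚ (+ a) b _) ε@(mkℚ +[1+ e ] d _) 0≤c 0<ε =
    a ℕ.* suc d , λ n N≤n →
      toℚᵘ-cancel-< (ℚᵘ.<-respˡ-≃
        (ℚᵘ.≃-sym (ℚᵘ.≃-trans (toℚᵘ-homo-* c (u n)) (ℚᵘ.*-congˡ {mkℚᵘ (+ a) b} (toℚᵘ-u n))))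
        (*<* (subst₂ ℤ._<_ (lhs n) refl (ℤ.+<+ (bound n N≤n)))))
    where
    lhs : ∀ n → + (a ℕ.* suc d) ≡ + a ℤ.* + 1 ℤ.* + suc d
    lhs n = trans (ℤ.pos-* a (suc d)) (cong (ℤ._* + suc d) (sym (ℤ.*-identityʳ (+ a))))
    bound : ∀ n → a ℕ.* suc d ℕ.≤ n → a ℕ.* suc d ℕ.< suc e ℕ.* (suc b ℕ.* suc n)
    bound n N≤n = ℕ.<-≤-trans (ℕ.s≤s N≤n)
      (ℕ.≤-trans (ℕ.m≤n*m (suc n) (suc b)) (ℕ.m≤n*m (suc b ℕ.* suc n) (suc e)))

  r→0 : ∀ D ε → 0ℚ ≤ D → 0ℚ < ε → ∃ λ N → ∀ n → N ℕ.≤ n → D * r n < ε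
  r→0 D ε 0≤D 0<ε
    with N , small ← archimedean (D * D * (+ 2 / 1)) (ε * ε)
                       (0≤* (0≤* 0≤D 0≤D) (nonNegative⁻¹ (+ 2 / 1))) (0<* 0<ε 0<ε) =
    N , λ n N≤n → ≰⇒> λ ε≤Dr → <-irrefl refl (begin-strict
      ε * ε
        ≤⟨ *-mono (<⇒≤ 0<ε) (0≤* 0≤D (0≤r n)) ε≤Dr ε≤Dr ⟩
      D * r n * (D * r n)
        ≡⟨ solve 2 (λ D r → D :* r :* (D :* r) := D :* D :* (r :* r)) refl D (r n) ⟩
      D * D * (r n * r n)
        ≤⟨ *-monoʳ (0≤* 0≤D 0≤D) (r²≤2u n) ⟩
      D * D * ((+ 2 / 1) * u (suc n))
        ≡⟨ *-assoc (D * D) (+ 2 / 1) (u (suc n)) ⟨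
      D * D * (+ 2 / 1) * u (suc n)
        <⟨ small (suc n) (ℕ.m≤n⇒m≤1+n N≤n) ⟩
      ε * ε ∎)

  antitone : ∀ (s : ℕ → ℚ) → (∀ k → s (suc k) ≤ s k) → ∀ {m n} → m ℕ.≤ n → s n ≤ s m
  antitone s step {m} m≤n = go (ℕ.≤⇒≤′ m≤n)
    where
    go : ∀ {n} → m ℕ.≤′ n → s n ≤ s m
    go (ℕ.≤′-reflexive refl) = ≤-refl
    go (ℕ.≤′-step m≤n)       = ≤-trans (step _) (go m≤n)

  series-cauchy : ∀ {q f C} → 2 ℕ.≤ q → Nonneg f → 0ℚ ≤ C → (∀ n → f n ≤ C * p ½ n) →
                  IsCauchy (λ N → Σ< N (λ n → 1/ suc n ^ q * f n))
  series-cauchy {q} {f} {C} 2≤q 0≤f 0≤C f≤ ε 0<ε = N , near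
    where
    D = (+ 4 / 1) * C
    0≤D = 0≤* (nonNegative⁻¹ (+ 4 / 1)) 0≤C
    tail = r→0 D ε 0≤D 0<ε
    N = proj₁ tail
    a : ℕ → ℚ
    a n = 1/ suc n ^ q * f n
    s : ℕ → ℚ
    s n = Σ< n a
    0≤a : Nonneg a
    0≤a n = 0≤* (0≤1/ n q) (0≤f n)
    a≤ : ∀ n → a n ≤ D * (½ * (r n * u (suc n)))
    a≤ n = begin
      1/ suc n ^ q * f n
        ≤⟨ *-mono (0≤f n) (0≤* (0≤u n) (0≤+ (0≤u (suc n)) (0≤u (suc n))))
             (≤-trans (1/≤u² n 2≤q) (*-monoʳ (0≤u n) (u≤2u n))) (f≤ n) ⟩
      u n * (u (suc n) + u (suc n)) * (C * p ½ n)
        ≡⟨ solve 4 (λ u v C p → u :* (v :+ v) :* (C :* p)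
                             := con (+ 4 / 1) :* C :* (con ½ :* (p :* u :* v)))
             refl (u n) (u (suc n)) C (p ½ n) ⟩
      D * (½ * (r n * u (suc n))) ∎
    s↗ : ∀ {m n} → m ℕ.≤ n → s m ≤ s n
    s↗ m≤n = neg-cancel-≤ (antitone (λ n → - s n) (λ n → neg-antimono-≤ (p≤p+q (s n) (0≤a n))) m≤n)
      where
      neg-cancel-≤ : ∀ {x y} → - x ≤ - y → y ≤ x
      neg-cancel-≤ {x} {y} -x≤-y = subst₂ _≤_ (neg-involutive y) (neg-involutive x) (neg-antimono-≤ -x≤-y)
        where
        neg-involutive : ∀ x → - - x ≡ x
        neg-involutive = solve 1 (λ x → :- (:- x) := x) refl
    s+Dr↘ : ∀ {m n} → m ℕ.≤ n → s n + D * r n ≤ s m + D * r m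
    s+Dr↘ = antitone (λ n → s n + D * r n) λ n → begin
      s n + a n + D * r (suc n)
        ≤⟨ +-monoˡ-≤ (D * r (suc n)) (+-monoʳ-≤ (s n) (a≤ n)) ⟩
      s n + D * (½ * (r n * u (suc n))) + D * r (suc n)
        ≡⟨ solve 4 (λ s D t r → s :+ D :* t :+ D :* r := s :+ D :* (r :+ t))
             refl (s n) D (½ * (r n * u (suc n))) (r (suc n)) ⟩
      s n + D * (r (suc n) + ½ * (r n * u (suc n)))
        ≡⟨ cong (λ e → s n + D * e) (r-step n) ⟨
      s n + D * r n ∎
    close : ∀ {m n} → N ℕ.≤ m → m ℕ.≤ n → ∣ s n - s m ∣ < ε
    close {m} {n} N≤m m≤n = begin-strict
      ∣ s n - s m ∣        ≡⟨ 0≤p⇒∣p∣≡p (p≤q⇒0≤q-p (s↗ m≤n)) ⟩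
      s n - s m            ≤⟨ +-monoˡ-≤ (- s m) (≤-trans (p≤p+q (s n) (0≤* 0≤D (0≤r n))) (s+Dr↘ m≤n)) ⟩
      s m + D * r m - s m  ≡⟨ solve 2 (λ s t → s :+ t :- s := t) refl (s m) (D * r m) ⟩
      D * r m              <⟨ proj₂ tail m N≤m ⟩
      ε                    ∎
      where
      p≤q⇒0≤q-p : ∀ {x y} → x ≤ y → 0ℚ ≤ y - x
      p≤q⇒0≤q-p {x} {y} x≤y = subst (_≤ y - x) (+-inverseʳ x) (+-monoˡ-≤ (- x) x≤y)
    near : ∀ m n → N ℕ.≤ m → N ℕ.≤ n → ∣ s m - s n ∣ < ε
    near m n N≤m N≤n with ℕ.≤-total m n
    ... | inj₂ n≤m = close N≤n n≤m
    ... | inj₁ m≤n = subst (_< ε)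
      (trans (sym (∣-p∣≡∣p∣ (s n - s m)))
             (cong ∣_∣ (solve 2 (λ a b → :- (a :- b) := b :- a) refl (s n) (s m))))
      (close N≤m m≤n)

-- The multiple series is summed as the limit of its truncations n₁ ≤ N;
-- its terms are positive.
ζ : (s₁ : ℕ) → 1 ℕ.< s₁ → List ℕ⁺ → ℝ
ζ s₁ 1<s₁ ss = mkℝ (λ N → mzvSum N (s₁ ∷ List.map value ss)) conv
  where
  conv : IsCauchy (λ N → mzvSum N (s₁ ∷ List.map value ss))
  conv = let _ , 0≤C , bound = bounded-mzvSum ss 0 in
    series-cauchy 1<s₁ (0≤mzvSum (List.map value ss)) 0≤C bound

S : ∀ {m} → (Fin m → ℕ⁺) → (q : ℕ) → 2 ℕ.≤ q → ℝ
S i q 2≤q = mkℝ (λ N → eulerSum N i q) conv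
  where
  conv : IsCauchy (λ N → eulerSum N i q)
  conv = let C , 0≤C , bound = bounded-∏H i 0 in
    series-cauchy 2≤q (λ n → 0≤∏H i (suc n)) (0≤+ 0≤C 0≤C) λ n → let x = p ½ n in begin
      foldr _*_ 1ℚ (λ j → H (suc n) (i j))
        ≤⟨ bound (suc n) ⟩
      C * (x + ½ * (u n * x))
        ≤⟨ *-monoʳ 0≤C (+-monoʳ-≤ x (*-mono (0≤* (0≤u n) (0≤p (0≤δ 0) n)) (nonNegative⁻¹ 1ℚ)
             (δ≤1 0) (*-monoˡ (0≤p (0≤δ 0) n) (u≤1 n)))) ⟩
      C * (x + 1ℚ * (1ℚ * x))
        ≡⟨ solve 2 (λ C x → C :* (x :+ con 1ℚ :* (con 1ℚ :* x)) := (C :+ C) :* x) refl C x ⟩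
      (C + C) * x ∎

1/factorials : ∀ {m} → Composition m → ℚ
1/factorials ξ = (+ 1 / factorials ξ) {{factorials≢0 ξ}}

{-# OPTIONS --safe #-}

-- The partial sums of the two sides agree exactly.  Since
-- mzvSum n (s ∷ ss) + 1/(n+1)^s mzvSum n ss = mzvSum (n + 1) (s ∷ ss), this
-- amounts to H_N(i₁) ⋯ H_N(iₘ) = Σ_σ g_N (i ∘ σ) for
-- g_N w = Σ_ξ 1/(ξ₁! ⋯ ξₚ!) mzvSum N (blockSums ξ w).
-- On words, g_{N+1} is the deconcatenation product of e_N and g_N, where
-- e_N w = 1/|w|! ∏_{c ∈ w} 1/(N+1)^c.  Summing over all insertions of a letter
-- c is a derivation of this product, which multiplies e_N by 1/(N+1)^c and
-- therefore multiplies g_N by H_N(c).  A sum over all permutations of a word is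
-- obtained by inserting its letters one after the other.
module Submission where

open import Defs
open import Data.Fin.Base using (Fin; zero; suc; punchIn)
open import Data.Fin.Permutation using (Permutation′; _⟨$⟩ʳ_; insert; insert-punchIn)
open import Data.Integer.Base using (+_)
import Data.Integer.Base as ℤ
import Data.Integer.Properties as ℤ
open import Data.List.Base
  using (List; []; _∷_; _++_; map; length; tabulate; allFin; concatMap)
open import Data.List.NonEmpty.Base using (head; tail; toList)
open import Data.List.Properties using (length-tabulate; map-tabulate; tabulate-cong)
open import Data.Nat.Base as ℕ using (ℕ; zero; suc; NonZero; _≤_; _+_; _!)
open import Data.Nat.Properties as ℕ using (m≤n⇒m≤n+o)
open import Data.Product.Base using (_,_)
open import Data.Rational.Base as ℚ using (ℚ; 0ℚ; 1ℚ; _/_; fromℚᵘ)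
  renaming (_+_ to infixl 6 _+ℚ_; _*_ to infixl 7 _*ℚ_)
open import Data.Rational.Properties as ℚ using (toℚᵘ-injective; toℚᵘ-fromℚᵘ; fromℚᵘ-cong)
open import Data.Rational.Solver using (module +-*-Solver)
open import Data.Rational.Unnormalised.Base as ℚᵘ using (mkℚᵘ; *≡*)
import Data.Rational.Unnormalised.Properties as ℚᵘ
open import Data.Refinement.Base using (value)
open import Data.Vec.Functional using (Vector; take; drop; foldr)
open import Relation.Binary.PropositionalEquality
  using (_≡_; _≗_; refl; sym; trans; cong; cong₂; subst; module ≡-Reasoning)

open +-*-Solver using (solve; _:+_; _:*_; _:=_; con)
open ≡-Reasoning

private variable
  A B : Set

-- Finite sums

sumℚ : List A → (A → ℚ) → ℚ
sumℚ []       f = 0ℚ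
sumℚ (x ∷ xs) f = f x +ℚ sumℚ xs f

sumℚ-cong : ∀ (xs : List A) {f g : A → ℚ} → f ≗ g → sumℚ xs f ≡ sumℚ xs g
sumℚ-cong []       f≗g = refl
sumℚ-cong (x ∷ xs) f≗g = cong₂ _+ℚ_ (f≗g x) (sumℚ-cong xs f≗g)

sumℚ-zero : ∀ (xs : List A) → sumℚ xs (λ _ → 0ℚ) ≡ 0ℚ
sumℚ-zero []       = refl
sumℚ-zero (x ∷ xs) = trans (ℚ.+-identityˡ _) (sumℚ-zero xs)

sumℚ-+ : ∀ (xs : List A) f g → sumℚ xs (λ x → f x +ℚ g x) ≡ sumℚ xs f +ℚ sumℚ xs g
sumℚ-+ []       f g = refl
sumℚ-+ (x ∷ xs) f g = trans (cong (f x +ℚ g x +ℚ_) (sumℚ-+ xs f g))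
  (solve 4 (λ a b c d → a :+ b :+ (c :+ d) := a :+ c :+ (b :+ d)) refl
    (f x) (g x) (sumℚ xs f) (sumℚ xs g))

sumℚ-* : ∀ (xs : List A) c f → sumℚ xs (λ x → c *ℚ f x) ≡ c *ℚ sumℚ xs f
sumℚ-* []       c f = sym (ℚ.*-zeroʳ c)
sumℚ-* (x ∷ xs) c f = trans (cong (c *ℚ f x +ℚ_) (sumℚ-* xs c f))
  (sym (ℚ.*-distribˡ-+ c (f x) (sumℚ xs f)))

sumℚ-++ : ∀ (xs ys : List A) f → sumℚ (xs ++ ys) f ≡ sumℚ xs f +ℚ sumℚ ys f
sumℚ-++ []       ys f = sym (ℚ.+-identityˡ _)
sumℚ-++ (x ∷ xs) ys f = trans (cong (f x +ℚ_) (sumℚ-++ xs ys f)) (sym (ℚ.+-assoc (f x) _ _))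

sumℚ-map : ∀ (h : A → B) xs f → sumℚ (map h xs) f ≡ sumℚ xs (λ x → f (h x))
sumℚ-map h []       f = refl
sumℚ-map h (x ∷ xs) f = cong (f (h x) +ℚ_) (sumℚ-map h xs f)

sumℚ-concatMap : ∀ (h : A → List B) xs f →
                 sumℚ (concatMap h xs) f ≡ sumℚ xs (λ x → sumℚ (h x) f)
sumℚ-concatMap h []       f = refl
sumℚ-concatMap h (x ∷ xs) f =
  trans (sumℚ-++ (h x) (concatMap h xs) f) (cong (sumℚ (h x) f +ℚ_) (sumℚ-concatMap h xs f))

sumℚ-swap : ∀ (xs : List A) (ys : List B) (f : A → B → ℚ) →
            sumℚ xs (λ x → sumℚ ys (f x)) ≡ sumℚ ys (λ y → sumℚ xs (λ x → f x y))
sumℚ-swap []       ys f = sym (sumℚ-zero ys)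
sumℚ-swap (x ∷ xs) ys f =
  trans (cong (sumℚ ys (f x) +ℚ_) (sumℚ-swap xs ys f)) (sym (sumℚ-+ ys (f x) _))

sumℚ-allFin : ∀ m (f : Fin (suc m) → ℚ) →
              sumℚ (allFin (suc m)) f ≡ f zero +ℚ sumℚ (allFin m) (λ k → f (suc k))
sumℚ-allFin m f = cong (f zero +ℚ_) (begin
  sumℚ (tabulate suc) f         ≡⟨ cong (λ ks → sumℚ ks f) (map-tabulate (λ k → k) suc) ⟨
  sumℚ (map suc (allFin m)) f   ≡⟨ sumℚ-map suc (allFin m) f ⟩
  sumℚ (allFin m) (λ k → f (suc k)) ∎)

-- `_+ℝ_` adds approximations index by index, so finite sums of reals can be compared through their
-- rational partial sums.
approx-sumℝ : ∀ (xs : List A) f n → approx (sumℝ xs f) n ≡ sumℚ xs (λ x → approx (f x) n)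
approx-sumℝ []       f n = refl
approx-sumℝ (x ∷ xs) f n = cong (approx (f x) n +ℚ_) (approx-sumℝ xs f n)

approx-sumℝ² : ∀ (xs : List A) (ys : List B) (f : A → B → ℝ) (h : A → B → ℚ) n →
  (∀ x y → approx (f x y) n ≡ h x y) →
  approx (sumℝ xs (λ x → sumℝ ys (f x))) n ≡ sumℚ xs (λ x → sumℚ ys (h x))
approx-sumℝ² xs ys f h n eq = trans
  (approx-sumℝ xs (λ x → sumℝ ys (f x)) n)
  (sumℚ-cong xs (λ x → trans (approx-sumℝ ys (f x) n) (sumℚ-cong ys (eq x))))

-- Insertions and deconcatenations

-- Recursions along a word absorb each letter already read into the functional.
∂ : A → (List A → ℚ) → List A → ℚ
∂ c f w = f (c ∷ w)

-- The sum of f over all words obtained by inserting c into w.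
D : A → (List A → ℚ) → List A → ℚ
D c f []      = f (c ∷ [])
D c f (y ∷ w) = f (c ∷ y ∷ w) +ℚ D c (∂ y f) w

-- The sum of f w₁ *ℚ g w₂ over all factorisations w = w₁ ++ w₂.
conv : (List A → ℚ) → (List A → ℚ) → List A → ℚ
conv f g []      = f [] *ℚ g []
conv f g (c ∷ w) = f [] *ℚ g (c ∷ w) +ℚ conv (∂ c f) g w

D-cong : ∀ (c : A) {f f′} → f ≗ f′ → D c f ≗ D c f′
D-cong c f≗f′ []      = f≗f′ _
D-cong c f≗f′ (y ∷ w) = cong₂ _+ℚ_ (f≗f′ _) (D-cong c (λ w → f≗f′ (y ∷ w)) w)

-- The combination `a *ℚ f +ℚ g` is the shape that `conv` takes on a nonempty word, seen as a
-- function of the remaining letters.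
D-linear : ∀ (c : A) a f g w → D c (λ w → a *ℚ f w +ℚ g w) w ≡ a *ℚ D c f w +ℚ D c g w
D-linear c a f g []      = refl
D-linear c a f g (y ∷ w) =
  trans (cong (a *ℚ f (c ∷ y ∷ w) +ℚ g (c ∷ y ∷ w) +ℚ_) (D-linear c a (∂ y f) (∂ y g) w))
    (solve 5 (λ a p q r s → a :* p :+ q :+ (a :* r :+ s) := a :* (p :+ r) :+ (q :+ s)) refl
      a (f (c ∷ y ∷ w)) (g (c ∷ y ∷ w)) (D c (∂ y f) w) (D c (∂ y g) w))

D-zero : ∀ (c : A) w → D c (λ _ → 0ℚ) w ≡ 0ℚ
D-zero c []      = refl
D-zero c (y ∷ w) = trans (ℚ.+-identityˡ _) (D-zero c w)

conv-+ˡ : ∀ (f f′ g : List A → ℚ) w → conv (λ w → f w +ℚ f′ w) g w ≡ conv f g w +ℚ conv f′ g w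
conv-+ˡ f f′ g []      = ℚ.*-distribʳ-+ (g []) (f []) (f′ [])
conv-+ˡ f f′ g (c ∷ w) =
  trans (cong ((f [] +ℚ f′ []) *ℚ g (c ∷ w) +ℚ_) (conv-+ˡ (∂ c f) (∂ c f′) g w))
    (solve 5 (λ p q r s t → (p :+ q) :* r :+ (s :+ t) := p :* r :+ s :+ (q :* r :+ t)) refl
      (f []) (f′ []) (g (c ∷ w)) (conv (∂ c f) g w) (conv (∂ c f′) g w))

-- The scaling is a pointwise hypothesis, the form in which `D-e` and `D-g` provide eigenvalues.
conv-*ˡ : ∀ a {f f′ : List A → ℚ} g → (∀ w → f′ w ≡ a *ℚ f w) → ∀ w → conv f′ g w ≡ a *ℚ conv f g w
conv-*ˡ a {f} g eq []      = trans (cong (_*ℚ g []) (eq [])) (ℚ.*-assoc a _ _)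
conv-*ˡ a {f} g eq (c ∷ w) =
  trans (cong₂ (λ p q → p *ℚ g (c ∷ w) +ℚ q) (eq []) (conv-*ˡ a g (λ w → eq (c ∷ w)) w))
    (solve 4 (λ a p q r → a :* p :* q :+ a :* r := a :* (p :* q :+ r)) refl
      a (f []) (g (c ∷ w)) (conv (∂ c f) g w))

conv-*ʳ : ∀ a f {g g′ : List A → ℚ} → (∀ w → g′ w ≡ a *ℚ g w) → ∀ w → conv f g′ w ≡ a *ℚ conv f g w
conv-*ʳ a f {g} eq []      = trans (cong (f [] *ℚ_) (eq []))
  (solve 3 (λ a p q → p :* (a :* q) := a :* (p :* q)) refl a (f []) (g []))
conv-*ʳ a f {g} eq (c ∷ w) =
  trans (cong₂ (λ p q → f [] *ℚ p +ℚ q) (eq (c ∷ w)) (conv-*ʳ a (∂ c f) eq w))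
    (solve 4 (λ a p q r → p :* (a :* q) :+ a :* r := a :* (p :* q :+ r)) refl
      a (f []) (g (c ∷ w)) (conv (∂ c f) g w))

-- Leibniz rule: inserting `c` and then cutting the word amounts to cutting first and inserting `c`
-- into one factor. At the cut itself, `c` may end the left factor or begin the right one.
D-conv : ∀ (c : A) f g w → D c (conv f g) w ≡ conv (D c f) g w +ℚ conv f (D c g) w
D-conv c f g []      = ℚ.+-comm (f [] *ℚ g (c ∷ [])) _
D-conv c f g (y ∷ w) = begin
  f₀ *ℚ g (c ∷ y ∷ w) +ℚ P +ℚ D c (λ w → f₀ *ℚ ∂ y g w +ℚ conv (∂ y f) g w) w
    ≡⟨ cong (f₀ *ℚ g (c ∷ y ∷ w) +ℚ P +ℚ_)
         (trans (D-linear c f₀ (∂ y g) (conv (∂ y f) g) w)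
                (cong (f₀ *ℚ D c (∂ y g) w +ℚ_) (D-conv c (∂ y f) g w))) ⟩
  f₀ *ℚ g (c ∷ y ∷ w) +ℚ (f (c ∷ []) *ℚ g (y ∷ w) +ℚ conv (∂ y (∂ c f)) g w)
    +ℚ (f₀ *ℚ D c (∂ y g) w +ℚ (conv (D c (∂ y f)) g w +ℚ conv (∂ y f) (D c g) w))
    ≡⟨ solve 8 (λ f₀ a b p q r s t →
         f₀ :* a :+ (p :* q :+ r) :+ (f₀ :* b :+ (s :+ t))
         := p :* q :+ (r :+ s) :+ (f₀ :* (a :+ b) :+ t)) refl
         f₀ (g (c ∷ y ∷ w)) (D c (∂ y g) w) (f (c ∷ [])) (g (y ∷ w))
         (conv (∂ y (∂ c f)) g w) (conv (D c (∂ y f)) g w) (conv (∂ y f) (D c g) w) ⟩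
  f (c ∷ []) *ℚ g (y ∷ w) +ℚ (conv (∂ y (∂ c f)) g w +ℚ conv (D c (∂ y f)) g w)
    +ℚ (f₀ *ℚ D c g (y ∷ w) +ℚ conv (∂ y f) (D c g) w)
    -- By definition `∂ y (D c f)` is the sum of `∂ y (∂ c f)` and `D c (∂ y f)`: either `c` lands
    -- before `y`, or `y` stays first.
    ≡⟨ cong (λ e → f (c ∷ []) *ℚ g (y ∷ w) +ℚ e +ℚ (f₀ *ℚ D c g (y ∷ w) +ℚ conv (∂ y f) (D c g) w))
         (conv-+ˡ (∂ y (∂ c f)) (D c (∂ y f)) g w) ⟨
  conv (D c f) g (y ∷ w) +ℚ conv f (D c g) (y ∷ w) ∎
  where
  f₀ = f []
  P = conv (∂ c f) g (y ∷ w)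

-- Sums over permutations

Sym : ∀ {m} → (List A → ℚ) → Vector A m → ℚ
Sym {m = m} f v = sumℚ (permutations m) (λ σ → f (tabulate (λ j → v (σ ⟨$⟩ʳ j))))

-- Sorts the permuted words by first letter `v k`: `insert zero k σ` sends `zero` to `k` and acts on
-- the rest as `σ` followed by `punchIn k`.
Sym-∂ : ∀ {m} (f : List A → ℚ) (v : Vector A (suc m)) →
        Sym f v ≡ sumℚ (allFin (suc m)) (λ k → Sym (∂ (v k) f) (λ j → v (punchIn k j)))
Sym-∂ {m = m} f v = trans
  (sumℚ-concatMap (λ k → map (insert zero k) (permutations m)) (allFin (suc m)) _)
  (sumℚ-cong (allFin (suc m)) λ k → trans
    (sumℚ-map (insert zero k) (permutations m) _)
    (sumℚ-cong (permutations m) λ σ → cong (λ w → f (v k ∷ w))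
      (tabulate-cong λ j → cong v (insert-punchIn zero k σ j))))

Sym-+ : ∀ {m} (f g : List A → ℚ) (v : Vector A m) → Sym (λ w → f w +ℚ g w) v ≡ Sym f v +ℚ Sym g v
Sym-+ {m = m} f g v = sumℚ-+ (permutations m) _ _

-- Each permutation of `v` arises once by inserting `v zero` into a permutation of the rest. Since
-- `permutations` chooses the first letter instead, the induction separates the case where that
-- letter is `v zero` from the others.
Sym-D : ∀ m (f : List A → ℚ) (v : Vector A (suc m)) →
        Sym f v ≡ Sym (D (v zero) f) (λ j → v (suc j))
Sym-D zero    f v = refl
Sym-D (suc m) f v = begin
  Sym f v
    ≡⟨ trans (Sym-∂ f v)
         (sumℚ-allFin (suc m) (λ k → Sym (∂ (v k) f) (λ j → v (punchIn k j)))) ⟩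
  Sym (∂ x f) v′ +ℚ
    sumℚ (allFin (suc m)) (λ k → Sym (∂ (v′ k) f) (λ j → v (punchIn (suc k) j)))
    -- `punchIn (suc k)` fixes `zero`, so `x` still heads the letters left after removing `v′ k`,
    -- and the induction hypothesis inserts it somewhere behind `v′ k`.
    ≡⟨ cong₂ _+ℚ_ (Sym-∂ (∂ x f) v′)
         (sumℚ-cong (allFin (suc m)) λ k →
           Sym-D m (∂ (v′ k) f) (λ j → v (punchIn (suc k) j))) ⟩
  sumℚ (allFin (suc m)) (λ k → Sym (∂ (v′ k) (∂ x f)) (λ j → v′ (punchIn k j))) +ℚ
    sumℚ (allFin (suc m)) (λ k → Sym (D x (∂ (v′ k) f)) (λ j → v′ (punchIn k j)))
    ≡⟨ sumℚ-+ (allFin (suc m))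
         (λ k → Sym (∂ (v′ k) (∂ x f)) (λ j → v′ (punchIn k j)))
         (λ k → Sym (D x (∂ (v′ k) f)) (λ j → v′ (punchIn k j))) ⟨
  sumℚ (allFin (suc m)) (λ k → Sym (∂ (v′ k) (∂ x f)) (λ j → v′ (punchIn k j)) +ℚ
                               Sym (D x (∂ (v′ k) f)) (λ j → v′ (punchIn k j)))
    ≡⟨ sumℚ-cong (allFin (suc m)) (λ k →
         Sym-+ (∂ (v′ k) (∂ x f)) (D x (∂ (v′ k) f)) (λ j → v′ (punchIn k j))) ⟨
  sumℚ (allFin (suc m)) (λ k → Sym (∂ (v′ k) (D x f)) (λ j → v′ (punchIn k j)))
    ≡⟨ Sym-∂ (D x f) v′ ⟨
  Sym (D x f) v′ ∎
  where
  x = v zero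
  v′ = λ j → v (suc j)

-- `Sym-D` takes off one letter at a time, and each leaves its eigenvalue as a factor.
Sym-eigen : ∀ {f : List A → ℚ} {h : A → ℚ} → f [] ≡ 1ℚ → (∀ c w → D c f w ≡ h c *ℚ f w) →
            ∀ m (v : Vector A m) → Sym f v ≡ foldr _*ℚ_ 1ℚ (λ j → h (v j))
Sym-eigen f[]≡1 eig zero    v = trans (ℚ.+-identityʳ _) f[]≡1
Sym-eigen {f = f} {h} f[]≡1 eig (suc m) v = begin
  Sym f v                       ≡⟨ Sym-D m f v ⟩
  Sym (D (v zero) f) v′         ≡⟨ sumℚ-cong (permutations m) (λ σ → eig (v zero) _) ⟩
  Sym (λ w → h (v zero) *ℚ f w) v′ ≡⟨ sumℚ-* (permutations m) (h (v zero)) _ ⟩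
  h (v zero) *ℚ Sym f v′        ≡⟨ cong (h (v zero) *ℚ_) (Sym-eigen {f = f} {h} f[]≡1 eig m v′) ⟩
  h (v zero) *ℚ foldr _*ℚ_ 1ℚ (λ j → h (v′ j)) ∎
  where
  v′ = λ j → v (suc j)

-- Reciprocals

fromℚᵘ-homo-* : ∀ p q → fromℚᵘ (p ℚᵘ.* q) ≡ fromℚᵘ p *ℚ fromℚᵘ q
fromℚᵘ-homo-* p q = toℚᵘ-injective (ℚᵘ.≃-trans (toℚᵘ-fromℚᵘ (p ℚᵘ.* q)) (ℚᵘ.≃-sym
  (ℚᵘ.≃-trans (ℚ.toℚᵘ-homo-* (fromℚᵘ p) (fromℚᵘ q))
              (ℚᵘ.*-cong (toℚᵘ-fromℚᵘ p) (toℚᵘ-fromℚᵘ q)))))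

fromℚᵘ-homo-+ : ∀ p q → fromℚᵘ (p ℚᵘ.+ q) ≡ fromℚᵘ p +ℚ fromℚᵘ q
fromℚᵘ-homo-+ p q = toℚᵘ-injective (ℚᵘ.≃-trans (toℚᵘ-fromℚᵘ (p ℚᵘ.+ q)) (ℚᵘ.≃-sym
  (ℚᵘ.≃-trans (ℚ.toℚᵘ-homo-+ (fromℚᵘ p) (fromℚᵘ q))
              (ℚᵘ.+-cong (toℚᵘ-fromℚᵘ p) (toℚᵘ-fromℚᵘ q)))))

1/-* : ∀ a b .{{_ : NonZero a}} .{{_ : NonZero b}} .{{_ : NonZero (a ℕ.* b)}} →
       (+ 1) / (a ℕ.* b) ≡ (+ 1 / a) *ℚ (+ 1 / b)
1/-* (suc a) (suc b) = fromℚᵘ-homo-* (mkℚᵘ (+ 1) a) (mkℚᵘ (+ 1) b)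

fromℕ : ℕ → ℚ
fromℕ n = + n / 1

fromℕ-suc : ∀ n → fromℕ (suc n) ≡ 1ℚ +ℚ fromℕ n
fromℕ-suc n = trans
  (fromℚᵘ-cong {mkℚᵘ (+ suc n) 0} {mkℚᵘ (+ 1) 0 ℚᵘ.+ mkℚᵘ (+ n) 0}
    (*≡* (cong (ℤ._* + 1) (cong (ℤ._+_ (+ 1)) (sym (ℤ.*-identityʳ (+ n)))))))
  (fromℚᵘ-homo-+ (mkℚᵘ (+ 1) 0) (mkℚᵘ (+ n) 0))

fromℕ-*-1/ : ∀ n → fromℕ (suc n) *ℚ (+ 1 / suc n) ≡ 1ℚ
fromℕ-*-1/ n = trans (sym (fromℚᵘ-homo-* (mkℚᵘ (+ suc n) 0) (mkℚᵘ (+ 1) n)))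
  (fromℚᵘ-cong {mkℚᵘ (+ suc n) 0 ℚᵘ.* mkℚᵘ (+ 1) n} {mkℚᵘ (+ 1) 0} (*≡* (begin
    + suc n ℤ.* + 1 ℤ.* + 1   ≡⟨ trans (ℤ.*-identityʳ _) (ℤ.*-identityʳ _) ⟩
    + suc n                   ≡⟨ cong +_ (trans (ℕ.*-identityˡ _) (ℕ.*-identityˡ _)) ⟨
    + (1 ℕ.* (1 ℕ.* suc n))   ≡⟨ ℤ.pos-* 1 _ ⟩
    + 1 ℤ.* + (1 ℕ.* suc n)   ∎)))

1/_! : ℕ → ℚ
1/ n ! = ((+ 1) / (n !)) {{n ℕ.!≢0}}

fromℕ-*-1/! : ∀ n → fromℕ (suc n) *ℚ 1/ suc n ! ≡ 1/ n !
fromℕ-*-1/! n = begin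
  fromℕ (suc n) *ℚ 1/ suc n !
    ≡⟨ cong (fromℕ (suc n) *ℚ_) (1/-* (suc n) (n !) {{_}} {{n ℕ.!≢0}} {{suc n ℕ.!≢0}}) ⟩
  fromℕ (suc n) *ℚ ((+ 1 / suc n) *ℚ 1/ n !)
    ≡⟨ ℚ.*-assoc (fromℕ (suc n)) _ _ ⟨
  fromℕ (suc n) *ℚ (+ 1 / suc n) *ℚ 1/ n !
    ≡⟨ trans (cong (_*ℚ 1/ n !) (fromℕ-*-1/ n)) (ℚ.*-identityˡ _) ⟩
  1/ n ! ∎

1/factorials-∷ : ∀ k {n} (ξ : Composition n) → 1/factorials (k ∷ ξ) ≡ 1/ suc k ! *ℚ 1/factorials ξ
1/factorials-∷ k ξ = 1/-* (suc k !) (factorials ξ)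
  {{suc k ℕ.!≢0}} {{factorials≢0 ξ}} {{factorials≢0 (k ∷ ξ)}}

1/^-+ : ∀ n .{{_ : NonZero n}} a b → 1/ n ^ (a + b) ≡ 1/ n ^ a *ℚ 1/ n ^ b
1/^-+ n a b = trans
  (ℚ./-cong {+ 1} {p₂ = + 1} {{ℕ.m^n≢0 n (a + b)}} {{ab≢0}} refl (ℕ.^-distribˡ-+-* n a b))
  (1/-* (n ℕ.^ a) (n ℕ.^ b) {{ℕ.m^n≢0 n a}} {{ℕ.m^n≢0 n b}} {{ab≢0}})
  where
  ab≢0 : NonZero (n ℕ.^ a ℕ.* n ℕ.^ b)
  ab≢0 = ℕ.m*n≢0 _ _ {{ℕ.m^n≢0 n a}} {{ℕ.m^n≢0 n b}}

-- The word functionals e and g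

∏ : (A → ℚ) → List A → ℚ
∏ x []      = 1ℚ
∏ x (c ∷ w) = x c *ℚ ∏ x w

-- `∏` ignores order, so all `suc (length w)` insertions have the same value. The weight `φ` is
-- general because passing `y` turns it into `λ n → x y *ℚ φ (suc n)`.
D-length-∏ : ∀ (φ : ℕ → ℚ) (x : A → ℚ) c w →
  D c (λ w → φ (length w) *ℚ ∏ x w) w
  ≡ fromℕ (suc (length w)) *ℚ (φ (suc (length w)) *ℚ (x c *ℚ ∏ x w))
D-length-∏ φ x c []      = sym (ℚ.*-identityˡ _)
D-length-∏ φ x c (y ∷ w) = begin
  t +ℚ D c (λ w → φ (suc (length w)) *ℚ (x y *ℚ ∏ x w)) w
    ≡⟨ cong (t +ℚ_) (D-cong c (λ w → reorder (φ (suc (length w))) (x y) (∏ x w)) w) ⟩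
  t +ℚ D c (λ w → (x y *ℚ φ (suc (length w))) *ℚ ∏ x w) w
    ≡⟨ cong (t +ℚ_) (D-length-∏ (λ n → x y *ℚ φ (suc n)) x c w) ⟩
  t +ℚ fromℕ n *ℚ ((x y *ℚ φ (suc n)) *ℚ (x c *ℚ ∏ x w))
    ≡⟨ solve 5 (λ f p y c w → p :* (c :* (y :* w)) :+ f :* (y :* p :* (c :* w))
                           := (con 1ℚ :+ f) :* (p :* (c :* (y :* w)))) refl
         (fromℕ n) (φ (suc n)) (x y) (x c) (∏ x w) ⟩
  (1ℚ +ℚ fromℕ n) *ℚ t
    ≡⟨ cong (_*ℚ t) (fromℕ-suc n) ⟨
  fromℕ (suc n) *ℚ t ∎
  where
  n = suc (length w)
  t = φ (suc n) *ℚ (x c *ℚ (x y *ℚ ∏ x w))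
  reorder : ∀ a b c → a *ℚ (b *ℚ c) ≡ (b *ℚ a) *ℚ c
  reorder = solve 3 (λ a b c → a :* (b :* c) := b :* a :* c) refl

-- The coefficient of `w` in the exponential of the formal sum of all `x c` times `c`, with the
-- letters as noncommuting variables.
e : (A → ℚ) → List A → ℚ
e x w = 1/ length w ! *ℚ ∏ x w

-- The number of equal insertions cancels the top factor of the factorial of `suc (length w)`.
D-e : ∀ (x : A → ℚ) c w → D c (e x) w ≡ x c *ℚ e x w
D-e x c w = begin
  D c (e x) w
    ≡⟨ D-length-∏ 1/_! x c w ⟩
  fromℕ (suc n) *ℚ (1/ suc n ! *ℚ (x c *ℚ ∏ x w))
    ≡⟨ solve 4 (λ a b c d → a :* (b :* (c :* d)) := c :* (a :* b :* d)) refl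
         (fromℕ (suc n)) (1/ suc n !) (x c) (∏ x w) ⟩
  x c *ℚ (fromℕ (suc n) *ℚ 1/ suc n ! *ℚ ∏ x w)
    ≡⟨ cong (λ a → x c *ℚ (a *ℚ ∏ x w)) (fromℕ-*-1/! n) ⟩
  x c *ℚ e x w ∎
  where
  n = length w

term : ℕ → ℕ⁺ → ℚ
term N s = 1/ suc N ^ value s

-- `g zero` is the unit of `conv`; each later factor is multiplied on the left, just as n₁ is the
-- largest index in `mzvSum`.
g : ℕ → List ℕ⁺ → ℚ
g zero    []      = 1ℚ
g zero    (_ ∷ _) = 0ℚ
g (suc N) w       = conv (e (term N)) (g N) w

g-[] : ∀ N → g N [] ≡ 1ℚ
g-[] zero    = refl
g-[] (suc N) = trans (ℚ.*-identityˡ (g N [])) (g-[] N)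

-- By `D-conv` the eigenvalues of `D c` add under `conv`, which builds up the harmonic sum. At
-- `zero` an insertion gives a nonempty word, where `g zero` vanishes.
D-g : ∀ N c w → D c (g N) w ≡ H N c *ℚ g N w
D-g zero    c []      = refl
D-g zero    c (y ∷ w) = trans (ℚ.+-identityˡ _) (D-zero c w)
D-g (suc N) c w = begin
  D c (conv eₙ (g N)) w
    ≡⟨ D-conv c eₙ (g N) w ⟩
  conv (D c eₙ) (g N) w +ℚ conv eₙ (D c (g N)) w
    ≡⟨ cong₂ _+ℚ_ (conv-*ˡ (term N c) (g N) (D-e (term N) c) w)
                  (conv-*ʳ (H N c) eₙ (D-g N c) w) ⟩
  term N c *ℚ g (suc N) w +ℚ H N c *ℚ g (suc N) w
    ≡⟨ solve 3 (λ a b c → a :* c :+ b :* c := (b :+ a) :* c) refl (term N c) (H N c) (g (suc N) w) ⟩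
  H (suc N) c *ℚ g (suc N) w ∎
  where
  eₙ = e (term N)

-- Sums over compositions

mzv : ℕ → List ℕ⁺ → ℚ
mzv N ss = mzvSum N (map value ss)

weightedMzv : ∀ {m} → ℕ → Vector ℕ⁺ m → Composition m → ℚ
weightedMzv N v ξ = 1/factorials ξ *ℚ mzv N (toList (blockSums ξ v))

-- Values the first block by `f` and the rest by its weighted sum. `f` is general because enlarging
-- the first part replaces it by `∂ (v zero) f`.
splitFirst : ∀ {m} → ℕ → (List ℕ⁺ → ℚ) → Vector ℕ⁺ m → Composition m → ℚ
splitFirst N f v (single k) = f (tabulate v)
splitFirst N f v (k ∷ ξ)    = f (tabulate (take (suc k) v)) *ℚ weightedMzv N (drop (suc k) v) ξ

splitFirst-increaseHead : ∀ {m} N f (v : Vector ℕ⁺ (suc m)) ξ →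
  splitFirst N f v (increaseHead ξ) ≡ splitFirst N (∂ (v zero) f) (λ j → v (suc j)) ξ
splitFirst-increaseHead N f v (single k) = refl
splitFirst-increaseHead N f v (k ∷ ξ)    = refl

module _ (N : ℕ)
  (g-mzv : ∀ n (v : Vector ℕ⁺ (suc n)) →
           sumℚ (compositions (suc n)) (weightedMzv N v) ≡ g N (tabulate v)) where

  -- A first block is a nonempty prefix, hence `∂ (v zero) f` in `conv`. If its length is 1,
  -- `g-mzv`, the outer induction hypothesis at `N`, sums over the rest; otherwise `increaseHead`
  -- leads to the recursion on `n`.
  sum-splitFirst : ∀ n f (v : Vector ℕ⁺ (suc n)) →
    sumℚ (compositions (suc n)) (splitFirst N f v) ≡ conv (∂ (v zero) f) (g N) (tabulate (λ j → v (suc j)))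
  sum-splitFirst zero    f v = trans (ℚ.+-identityʳ (f (v zero ∷ [])))
    (sym (trans (cong (f (v zero ∷ []) *ℚ_) (g-[] N)) (ℚ.*-identityʳ (f (v zero ∷ [])))))
  sum-splitFirst (suc n) f v = begin
    sumℚ (map (0 ∷_) ξs ++ map increaseHead ξs) (splitFirst N f v)
      ≡⟨ sumℚ-++ (map (0 ∷_) ξs) _ _ ⟩
    sumℚ (map (0 ∷_) ξs) (splitFirst N f v) +ℚ sumℚ (map increaseHead ξs) (splitFirst N f v)
      ≡⟨ cong₂ _+ℚ_ (sumℚ-map (0 ∷_) ξs _) (sumℚ-map increaseHead ξs _) ⟩
    sumℚ ξs (λ ξ → f (v zero ∷ []) *ℚ weightedMzv N v′ ξ) +ℚ
      sumℚ ξs (λ ξ → splitFirst N f v (increaseHead ξ))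
      ≡⟨ cong₂ _+ℚ_
           (trans (sumℚ-* ξs (f (v zero ∷ [])) _) (cong (f (v zero ∷ []) *ℚ_) (g-mzv n v′)))
           (trans (sumℚ-cong ξs (splitFirst-increaseHead N f v)) (sum-splitFirst n (∂ (v zero) f) v′)) ⟩
    conv (∂ (v zero) f) (g N) (tabulate v′) ∎
    where
    ξs = compositions (suc n)
    v′ = λ j → v (suc j)

term-sum⁺ : ∀ N k (v : Vector ℕ⁺ (suc k)) → term N (sum⁺ v) ≡ ∏ (term N) (tabulate v)
term-sum⁺ N zero    v = sym (ℚ.*-identityʳ _)
term-sum⁺ N (suc k) v = trans (1/^-+ (suc N) (value (v zero)) _)
  (cong (term N (v zero) *ℚ_) (term-sum⁺ N k (λ j → v (suc j))))

-- Links `e` to compositions: the factorial of the word length is that of the part, and the product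
-- over letters is a single power whose exponent is the block sum.
e-tabulate : ∀ N k (v : Vector ℕ⁺ (suc k)) →
             e (term N) (tabulate v) ≡ 1/ suc k ! *ℚ term N (sum⁺ v)
e-tabulate N k v = cong₂ _*ℚ_ (cong 1/_! (length-tabulate v)) (sym (term-sum⁺ N k v))

-- The left side is the contribution of n₁ = N + 1 to the truncated multiple sum.
splitFirst-e : ∀ {m} N (v : Vector ℕ⁺ m) ξ →
  1/factorials ξ *ℚ (term N (head (blockSums ξ v)) *ℚ mzv N (tail (blockSums ξ v)))
  ≡ splitFirst N (e (term N)) v ξ
splitFirst-e N v (single k) = trans
  (cong (1/ suc k ! *ℚ_) (ℚ.*-identityʳ _)) (sym (e-tabulate N k v))
splitFirst-e N v (k ∷ ξ) = begin
  1/factorials (k ∷ ξ) *ℚ (t *ℚ M)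
    ≡⟨ cong (_*ℚ (t *ℚ M)) (1/factorials-∷ k ξ) ⟩
  1/ suc k ! *ℚ 1/factorials ξ *ℚ (t *ℚ M)
    ≡⟨ solve 4 (λ a b t M → a :* b :* (t :* M) := a :* t :* (b :* M)) refl
         (1/ suc k !) (1/factorials ξ) t M ⟩
  1/ suc k ! *ℚ t *ℚ (1/factorials ξ *ℚ M)
    ≡⟨ cong (_*ℚ (1/factorials ξ *ℚ M)) (e-tabulate N k (take (suc k) v)) ⟨
  splitFirst N (e (term N)) v (k ∷ ξ) ∎
  where
  t = term N (sum⁺ (take (suc k) v))
  M = mzv N (toList (blockSums ξ (drop (suc k) v)))

sum-weightedMzv : ∀ N n (v : Vector ℕ⁺ (suc n)) →
  sumℚ (compositions (suc n)) (weightedMzv N v) ≡ g N (tabulate v)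
sum-weightedMzv zero    n v = trans
  (sumℚ-cong (compositions (suc n)) (λ ξ → ℚ.*-zeroʳ (1/factorials ξ)))
  (sumℚ-zero (compositions (suc n)))
sum-weightedMzv (suc N) n v = begin
  sumℚ ξs (weightedMzv (suc N) v)
    -- `mzvSum` unfolds into the terms with n₁ ≤ N and those with n₁ = N + 1.
    ≡⟨ sumℚ-cong ξs (λ ξ → ℚ.*-distribˡ-+ (1/factorials ξ) (mzv N (toList (blockSums ξ v))) _) ⟩
  sumℚ ξs (λ ξ → weightedMzv N v ξ +ℚ
    1/factorials ξ *ℚ (term N (head (blockSums ξ v)) *ℚ mzv N (tail (blockSums ξ v))))
    ≡⟨ sumℚ-+ ξs _ _ ⟩
  sumℚ ξs (weightedMzv N v) +ℚ sumℚ ξs (λ ξ →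
    1/factorials ξ *ℚ (term N (head (blockSums ξ v)) *ℚ mzv N (tail (blockSums ξ v))))
    ≡⟨ cong₂ _+ℚ_ (sum-weightedMzv N n v)
         (trans (sumℚ-cong ξs (splitFirst-e N v))
                (sum-splitFirst N (sum-weightedMzv N) n (e (term N)) v)) ⟩
  g N (tabulate v) +ℚ conv (∂ (v zero) (e (term N))) (g N) (tabulate (λ j → v (suc j)))
    -- `e` is 1 on the empty word, so the terms with n₁ ≤ N supply the empty-prefix summand of
    -- `conv`.
    ≡⟨ cong (_+ℚ conv (∂ (v zero) (e (term N))) (g N) (tabulate (λ j → v (suc j))))
         (ℚ.*-identityˡ (g N (tabulate v))) ⟨
  g (suc N) (tabulate v) ∎
  where
  ξs = compositions (suc n)

-- For m = 0 the product would be 1 but `compositions 0` is empty, hence `1 ≤ m`.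
∏H≡ΣΣ : ∀ N m → 1 ≤ m → (i : Vector ℕ⁺ m) →
  foldr _*ℚ_ 1ℚ (λ j → H N (i j)) ≡
  sumℚ (compositions m) (λ ξ → sumℚ (permutations m) (λ σ →
    1/factorials ξ *ℚ mzv N (toList (J i ξ σ))))
∏H≡ΣΣ N m@(suc _) _ i = begin
  foldr _*ℚ_ 1ℚ (λ j → H N (i j))
    ≡⟨ Sym-eigen {h = H N} (g-[] N) (D-g N) m i ⟨
  Sym (g N) i
    ≡⟨ sumℚ-cong (permutations m) (λ σ → sum-weightedMzv N _ (λ j → i (σ ⟨$⟩ʳ j))) ⟨
  sumℚ (permutations m) (λ σ → sumℚ (compositions m) (λ ξ →
    1/factorials ξ *ℚ mzv N (toList (J i ξ σ))))
    ≡⟨ sumℚ-swap (permutations m) (compositions m) _ ⟩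
  sumℚ (compositions m) (λ ξ → sumℚ (permutations m) (λ σ →
    1/factorials ξ *ℚ mzv N (toList (J i ξ σ)))) ∎

-- The partial sums

-- Definitionally the `N`-th approximation of one summand on the right-hand side.
partial : ∀ {m} → (Fin m → ℕ⁺) → ℕ → ℕ → Composition m → Permutation′ m → ℚ
partial i q N ξ σ = 1/factorials ξ *ℚ
  (mzvSum N (q ∷ map value (toList (J i ξ σ))) +ℚ
   mzvSum N (q + value (head (J i ξ σ)) ∷ map value (tail (J i ξ σ))))

-- This is why two zeta values occur. At outer index N + 1 the first contributes the inner sums with
-- leading index at most N; the second, whose exponents have merged, those with leading index N + 1.
-- Together they form the inner sum truncated at N + 1.
partial-suc : ∀ {m} (i : Fin m → ℕ⁺) q N ξ σ →
  partial i q (suc N) ξ σ ≡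
  partial i q N ξ σ +ℚ 1/ suc N ^ q *ℚ (1/factorials ξ *ℚ mzv (suc N) (toList (J i ξ σ)))
partial-suc i q N ξ σ = trans
  (cong (λ t → f *ℚ (a +ℚ x *ℚ M +ℚ (b +ℚ t *ℚ M′))) (1/^-+ (suc N) q (value s)))
  (solve 7 (λ f a b x y M M′ → f :* (a :+ x :* M :+ (b :+ x :* y :* M′))
                            := f :* (a :+ b) :+ x :* (f :* (M :+ y :* M′))) refl
    f a b x (term N s) M M′)
  where
  s = head (J i ξ σ)
  f = 1/factorials ξ
  a = mzvSum N (q ∷ map value (toList (J i ξ σ)))
  b = mzvSum N (q + value s ∷ map value (tail (J i ξ σ)))
  x = 1/ suc N ^ q
  M = mzv N (toList (J i ξ σ))
  M′ = mzv N (tail (J i ξ σ))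

eulerSum≡ΣΣ : ∀ m → 1 ≤ m → (i : Fin m → ℕ⁺) → ∀ q N →
  eulerSum N i q ≡
  sumℚ (compositions m) (λ ξ → sumℚ (permutations m) (partial i q N ξ))
eulerSum≡ΣΣ m 1≤m i q zero    = sym (trans
  (sumℚ-cong ξs (λ ξ → trans (sumℚ-cong σs (λ σ → ℚ.*-zeroʳ (1/factorials ξ))) (sumℚ-zero σs)))
  (sumℚ-zero ξs))
  where
  ξs = compositions m
  σs = permutations m
eulerSum≡ΣΣ m 1≤m i q (suc N) = begin
  eulerSum N i q +ℚ x *ℚ foldr _*ℚ_ 1ℚ (λ j → H (suc N) (i j))
    -- The new Euler term has n = N + 1, so the product formula is taken at `suc N`, matching
    -- `mzv (suc N)` in `partial-suc`.
    ≡⟨ cong₂ (λ a b → a +ℚ x *ℚ b) (eulerSum≡ΣΣ m 1≤m i q N) (∏H≡ΣΣ (suc N) m 1≤m i) ⟩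
  sumℚ ξs (λ ξ → sumℚ σs (partial i q N ξ)) +ℚ x *ℚ sumℚ ξs (λ ξ → sumℚ σs (new ξ))
    ≡⟨ cong (sumℚ ξs (λ ξ → sumℚ σs (partial i q N ξ)) +ℚ_) (sumℚ-* ξs x _) ⟨
  sumℚ ξs (λ ξ → sumℚ σs (partial i q N ξ)) +ℚ sumℚ ξs (λ ξ → x *ℚ sumℚ σs (new ξ))
    ≡⟨ sumℚ-+ ξs _ _ ⟨
  sumℚ ξs (λ ξ → sumℚ σs (partial i q N ξ) +ℚ x *ℚ sumℚ σs (new ξ))
    ≡⟨ sumℚ-cong ξs (λ ξ → begin
         sumℚ σs (partial i q (suc N) ξ)
           ≡⟨ sumℚ-cong σs (partial-suc i q N ξ) ⟩
         sumℚ σs (λ σ → partial i q N ξ σ +ℚ x *ℚ new ξ σ)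
           ≡⟨ sumℚ-+ σs _ _ ⟩
         sumℚ σs (partial i q N ξ) +ℚ sumℚ σs (λ σ → x *ℚ new ξ σ)
           ≡⟨ cong (sumℚ σs (partial i q N ξ) +ℚ_) (sumℚ-* σs x _) ⟩
         sumℚ σs (partial i q N ξ) +ℚ x *ℚ sumℚ σs (new ξ) ∎) ⟨
  sumℚ ξs (λ ξ → sumℚ σs (partial i q (suc N) ξ)) ∎
  where
  ξs = compositions m
  σs = permutations m
  x = 1/ suc N ^ q
  new : Composition m → Permutation′ m → ℚ
  new ξ σ = 1/factorials ξ *ℚ mzv (suc N) (toList (J i ξ σ))

≗⇒≃ : ∀ x y → approx x ≗ approx y → x ≃ y
-- The approximations agree at every index, so the threshold 0 serves every `ε`.
≗⇒≃ x y x≗y ε 0<ε = 0 , λ n _ →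
  subst (ℚ._< ε) (sym (cong ℚ.∣_∣ (trans (cong (ℚ._- approx y n) (x≗y n)) (ℚ.+-inverseʳ (approx y n))))) 0<ε

≃-sumℝ² : ∀ x (xs : List A) (ys : List B) (f : A → B → ℝ) (h : ℕ → A → B → ℚ) →
  (∀ a b n → approx (f a b) n ≡ h n a b) →
  (∀ n → approx x n ≡ sumℚ xs (λ a → sumℚ ys (h n a))) →
  x ≃ sumℝ xs (λ a → sumℝ ys (λ b → f a b))
≃-sumℝ² x xs ys f h f≡h x≡ = ≗⇒≃ x (sumℝ xs (λ a → sumℝ ys (f a))) λ n →
  trans (x≡ n) (sym (approx-sumℝ² xs ys f (h n) n (λ a b → f≡h a b n)))

theorem2p1 : ∀ (m : ℕ) → 1 ≤ m → (i : Fin m → ℕ⁺) (q : ℕ) (2≤q : 2 ≤ q) →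
    S i q 2≤q ≃
    sumℝ (compositions m) (λ ξ → sumℝ (permutations m) (λ σ →
    1/factorials ξ ·
    (ζ q 2≤q (toList (J i ξ σ)) +ℝ
    ζ (q + value (head (J i ξ σ)))
    (m≤n⇒m≤n+o (value (head (J i ξ σ))) 2≤q)
    (tail (J i ξ σ)))))
theorem2p1 m 1≤m i q 2≤q = ≃-sumℝ² (S i q 2≤q) (compositions m) (permutations m)
  (λ ξ σ → 1/factorials ξ ·
    (ζ q 2≤q (toList (J i ξ σ)) +ℝ
     ζ (q + value (head (J i ξ σ)))
       (m≤n⇒m≤n+o (value (head (J i ξ σ))) 2≤q)
       (tail (J i ξ σ))))
  (partial i q) (λ _ _ _ → refl) (eulerSum≡ΣΣ m 1≤m i q)
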